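{- For each integer $r\ge 3$ let $f_{(R),r,2}(x)=1+x^2+x^{2^r+1}+x^{2^r+2}\in\mathbb{F}_2[x]$ (this is the reciprocal polynomial of $1+x+x^{2^r}+x^{2^r+2}$). Then for every $r\ge 3$ the polynomial $f_{(R),r,2}$ is robust and its order divides $4^r+2^r+1$; moreover $\displaystyle\lim_{r\to\infty}\gamma(f_{(R),r,2})=1$.
   Context: For a polynomial $f$ of degree $n$, its reciprocal polynomial is $f_{(R)}(x)=x^nf(1/x)$. For $f\in\mathbb{F}_2[x]$ with $f(0)=1$ and $\deg f\ge 1$, the order $\operatorname{ord}(f)$ is the least integer $D\ge 1$ such that $f(x)\mid 1+x^D$ in $\mathbb{F}_2[x]$. With $D=\operatorname{ord}(f)$, let $f^*(x)\in\mathbb{F}_2[x]$ be defined by $f(x)f^*(x)=1+x^D$. For $g\in\mathbb{F}_2[x]$, $\ell_1(g)$ is the number of monomials of $g$ (terms with coefficient $1$), and for $N\ge\deg g$, $\ell_{0,N}(g)$ is the number of exponents $k\in\{0,1,\dots,N\}$ for which the coefficient of $x^k$ in $g$ is $0$. Define $\gamma(f)=\ell_1(f^*)/D$. The polynomial $f$ is called robust if $\ell_1(f^*)>\ell_{0,D-1}(f^*)+1$, equivalently $\ell_1(f^*)>(D+1)/2$. -}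

module Defs where

open import Algebra.Bundles.Raw using (RawMagma)
import Algebra.Definitions.RawMagma as MagmaDefinitions
open import Data.Bool.Base using (Bool; true; false; not; _∧_; _xor_)
open import Data.Integer.Base using (+_)
open import Data.List.Base
  using (List; []; _∷_; [_]; _++_; dropWhileᵇ; filterᵇ; length; map; replicate; reverse; upTo)
open import Data.Nat.Base using (ℕ; zero; suc; _+_; _∸_; _^_; _≤_; _>_; NonZero)
open import Data.Rational.Base using (ℚ; _/_)
open import Function.Base using (_∘_; id)
open import Level using (0ℓ)
open import Relation.Binary.PropositionalEquality.Core using (_≡_)

-- The field 𝔽₂ is Bool with _xor_ as addition and _∧_ as multiplication.
-- The list a₀ ∷ a₁ ∷ … stands for a₀ + a₁x + …; trailing zeros are allowed,
-- so equality of polynomials is _≈_ and not _≡_.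
𝔽₂[x] : Set
𝔽₂[x] = List Bool

coeff : 𝔽₂[x] → ℕ → Bool
coeff []      _       = false
coeff (a ∷ f) zero    = a
coeff (a ∷ f) (suc k) = coeff f k

infix 4 _≈_
_≈_ : 𝔽₂[x] → 𝔽₂[x] → Set
f ≈ g = ∀ k → coeff f k ≡ coeff g k

infixl 6 _⊕_
_⊕_ : 𝔽₂[x] → 𝔽₂[x] → 𝔽₂[x]
[]      ⊕ g       = g
(a ∷ f) ⊕ []      = a ∷ f
(a ∷ f) ⊕ (b ∷ g) = (a xor b) ∷ (f ⊕ g)

infixl 7 _⊗_
_⊗_ : 𝔽₂[x] → 𝔽₂[x] → 𝔽₂[x]
[]      ⊗ g = []
(a ∷ f) ⊗ g = map (a ∧_) g ⊕ (false ∷ (f ⊗ g))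

X^ : ℕ → 𝔽₂[x]
X^ n = replicate n false ++ [ true ]

𝟙 : 𝔽₂[x]
𝟙 = X^ 0

⊗-rawMagma : RawMagma 0ℓ 0ℓ
⊗-rawMagma = record { Carrier = 𝔽₂[x] ; _≈_ = _≈_ ; _∙_ = _⊗_ }

open MagmaDefinitions ⊗-rawMagma public using () renaming (_∣ˡ_ to _∣ₚ_)

-- xⁿ f(1/x) for n the degree of f.  The zeros dropped from the front of
-- reverse f are the trailing zeros of the list f, so n is the true degree.
reciprocal : 𝔽₂[x] → 𝔽₂[x]
reciprocal f = dropWhileᵇ not (reverse f)

-- The zero polynomial gets degree 0.
degree : 𝔽₂[x] → ℕ
degree f = length (dropWhileᵇ not (reverse f)) ∸ 1

ℓ₁ : 𝔽₂[x] → ℕ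
ℓ₁ g = length (filterᵇ id g)

ℓ₀ : ℕ → 𝔽₂[x] → ℕ
ℓ₀ N g = length (filterᵇ (not ∘ coeff g) (upTo (suc N)))

-- The order D of f together with the polynomial f* such that f f* = 1 + x^D.
-- Both are determined by f (f* up to _≈_).
record Order (f : 𝔽₂[x]) : Set where
  field
    constantTerm : coeff f 0 ≡ true
    nonConstant  : 1 ≤ degree f
    ord          : ℕ
    {{ord≢0}}    : NonZero ord
    dual         : 𝔽₂[x]
    f⊗dual       : f ⊗ dual ≈ 𝟙 ⊕ X^ ord
    minimal      : ∀ D → 1 ≤ D → f ∣ₚ 𝟙 ⊕ X^ D → ord ≤ D

open Order public using (ord; dual)

γ : ∀ {f} → Order f → ℚ
γ o = (+ ℓ₁ (dual o)) / ord o
  where instance _ = Order.ord≢0 o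

Robust : ∀ {f} → Order f → Set
Robust o = ℓ₁ (dual o) > ℓ₀ (ord o ∸ 1) (dual o) + 1

f₂ : ℕ → 𝔽₂[x]
f₂ r = 𝟙 ⊕ X^ 1 ⊕ X^ (2 ^ r) ⊕ X^ (2 ^ r + 2)

fR₂ : ℕ → 𝔽₂[x]
fR₂ r = 𝟙 ⊕ X^ 2 ⊕ X^ (2 ^ r + 1) ⊕ X^ (2 ^ r + 2)

{-# OPTIONS --safe #-}
-- Put q = 2^r and t = 1 + x + x^(q+1), so that f = fR₂ r is (1 + x) t.  Since
-- t^q = 1 + x^q + x^(q²+q), we get 1 + x^N = t (1 + x t^(q-1)) for N = q² + q + 1.
-- The coefficient of x^(a+qb), a < q, in t^(q-1) is C(a,b) mod 2, and dividing
-- 1 + x t^(q-1) by 1 + x turns it into 1 + C(a,b+1) for b < q, and 0 for b ≥ q.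
-- By the self-similarity of Pascal's triangle mod 2, exactly 3^r + 1 of the N
-- coefficients of (1 + x^N)/f vanish.  The power series 1/f has period N, its
-- least period is D = ord f, and f* consists of its first D terms; hence D ∣ N and
-- 1 - γ(f) = (3^r + 1)/N, whatever the value of D.
module Submission where

open import Defs
open import Algebra.Definitions.RawMagma ⊗-rawMagma using (_,_)
open import Data.Bool.Base using (Bool; true; false; not; _∧_; _xor_)
open import Data.Bool.Properties as Bool
  using (xor-identityʳ; xor-same; ∧-distribˡ-xor; ∧-zeroʳ; ∧-identityʳ; not-involutive)
open import Data.Bool.Solver using (module xor-∧-Solver)
open import Data.Integer.Base as ℤ using (+<+)
import Data.Integer.Properties as ℤ
open import Data.Integer.Tactic.RingSolver using () renaming (solve-∀ to ℤ-solve-∀)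
open import Data.List.Base
  using ([]; _∷_; [_]; _++_; applyUpTo; dropWhileᵇ; filterᵇ; length; map; replicate; reverse)
open import Data.List.Properties as List using (reverse-++; unfold-reverse)
open import Data.Nat.Base
open import Data.Nat.DivMod
open import Data.Nat.Divisibility using (_∣_; divides; m%n≡0⇒n∣m; n∣m*n; ∣1⇒≡1)
open import Data.Nat.GCD using (gcd-greatest)
open import Data.Nat.Properties
open import Data.Nat.Tactic.RingSolver using (solve-∀)
open import Data.Product using (_×_; ∃; _,_)
open import Data.Rational.Base as ℚ using (ℚ; 0ℚ; 1ℚ; mkℚ)
import Data.Rational.Properties as ℚ
open import Data.Rational.Unnormalised.Base as ℚᵘ using (mkℚᵘ; *≡*; *<*)
import Data.Rational.Unnormalised.Properties as ℚᵘ
open import Data.Sum.Base using (inj₁; inj₂)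
open import Function.Base using (_∘_; id)
open import Relation.Binary.PropositionalEquality hiding ([_])
open import Relation.Nullary using (Dec; yes; no; contradiction)
open import Relation.Nullary.Decidable using (map′)
open xor-∧-Solver using (solve; _:=_; _:+_; _:*_; con)

-- The number N arises because t and x t^q share the terms x + x^(q+1), which cancel in t + x t^q =
-- t (1 + x t^(q-1)). The binomials come from expanding t^(q-1) = (1 + x (1 + x^q))^(q-1): every
-- C(q-1,a) is odd, so it equals the sum over a < q of x^a (1 + x^q)^a. The code never raises t to a
-- power. It writes the coefficients down and checks them against the two multiplications, by t and
-- by 1 + x.
--
-- The obstacle is that the order itself stays unknown: only its divisibility into N is established.
-- Counts are therefore made over N and carried to one least period through an unspecified factor m.
-- The limit does not see m, but robustness has an additive 1 that does not scale with m, so it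
-- needs a margin, and r = 3 has to be settled by arithmetic. Since `Order` is quantified over, with
-- `dual` fixed only up to trailing zeros, every such record is compared with the one series 1/f.

-- Formal power series over 𝔽₂.
Series : Set
Series = ℕ → Bool

infixl 6 _⊞_
_⊞_ : Series → Series → Series
(s ⊞ t) k = s k xor t k

shift : ℕ → Series → Series
shift zero    s k       = s k
shift (suc n) s zero    = false
shift (suc n) s (suc k) = shift n s k

shift-+ : ∀ n s k → shift n s (n + k) ≡ s k
shift-+ zero    s k = refl
shift-+ (suc n) s k = shift-+ n s k

shift-< : ∀ {n k} s → k < n → shift n s k ≡ false
shift-< {suc n} {zero}  s k<n       = refl
shift-< {suc n} {suc k} s (s<s k<n) = shift-< s k<n

shift-cong : ∀ n {s t} → s ≗ t → shift n s ≗ shift n t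
shift-cong zero    e k       = e k
shift-cong (suc n) e zero    = refl
shift-cong (suc n) e (suc k) = shift-cong n e k

shift-⊞ : ∀ n s t → shift n (s ⊞ t) ≗ shift n s ⊞ shift n t
shift-⊞ zero    s t k       = refl
shift-⊞ (suc n) s t zero    = refl
shift-⊞ (suc n) s t (suc k) = shift-⊞ n s t k

shift-shift : ∀ m n s → shift m (shift n s) ≗ shift (m + n) s
shift-shift zero    n s k       = refl
shift-shift (suc m) n s zero    = refl
shift-shift (suc m) n s (suc k) = shift-shift m n s k

coeff-X^ : ∀ n → coeff (X^ n) ≗ shift n (coeff 𝟙)
coeff-X^ zero    k       = refl
coeff-X^ (suc n) zero    = refl
coeff-X^ (suc n) (suc k) = coeff-X^ n k

coeff-⊕ : ∀ f g → coeff (f ⊕ g) ≗ coeff f ⊞ coeff g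
coeff-⊕ []      g       k       = refl
coeff-⊕ (a ∷ f) []      k       = sym (xor-identityʳ _)
coeff-⊕ (a ∷ f) (b ∷ g) zero    = refl
coeff-⊕ (a ∷ f) (b ∷ g) (suc k) = coeff-⊕ f g k

coeff-map : ∀ a g k → coeff (map (a ∧_) g) k ≡ a ∧ coeff g k
coeff-map a []      k       = sym (∧-zeroʳ a)
coeff-map a (b ∷ g) zero    = refl
coeff-map a (b ∷ g) (suc k) = coeff-map a g k

coeff-∷ : ∀ f → coeff (false ∷ f) ≗ shift 1 (coeff f)
coeff-∷ f zero    = refl
coeff-∷ f (suc k) = refl

coeff-1⊕X^ : ∀ n → coeff (𝟙 ⊕ X^ n) ≗ coeff 𝟙 ⊞ shift n (coeff 𝟙)
coeff-1⊕X^ n k = trans (coeff-⊕ 𝟙 (X^ n) k) (cong (coeff 𝟙 k xor_) (coeff-X^ n k))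

coeff-length : ∀ f {k} → length f ≤ k → coeff f k ≡ false
coeff-length []      _         = refl
coeff-length (a ∷ f) (s≤s f≤k) = coeff-length f f≤k

-- Polynomials acting on power series.

infixr 7 _⊛_
-- The inverse 1/f is an infinite series, so `_⊗_` cannot express f · (1/f). Recursion on the finite
-- left factor avoids convolution sums.
_⊛_ : 𝔽₂[x] → Series → Series
([]      ⊛ s) k = false
((a ∷ f) ⊛ s) k = (a ∧ s k) xor shift 1 (f ⊛ s) k

coeff-⊗ : ∀ f g → coeff (f ⊗ g) ≗ f ⊛ coeff g
coeff-⊗ []      g k = refl
coeff-⊗ (a ∷ f) g k = begin
  coeff (map (a ∧_) g ⊕ (false ∷ (f ⊗ g))) k
    ≡⟨ coeff-⊕ (map (a ∧_) g) (false ∷ (f ⊗ g)) k ⟩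
  coeff (map (a ∧_) g) k xor coeff (false ∷ (f ⊗ g)) k
    ≡⟨ cong₂ _xor_ (coeff-map a g k) (coeff-∷ (f ⊗ g) k) ⟩
  (a ∧ coeff g k) xor shift 1 (coeff (f ⊗ g)) k
    ≡⟨ cong ((a ∧ coeff g k) xor_) (shift-cong 1 (coeff-⊗ f g) k) ⟩
  (a ∧ coeff g k) xor shift 1 (f ⊛ coeff g) k ∎
  where open ≡-Reasoning

-- Causality of multiplication: no coefficient of the product looks ahead. The induction in
-- `⊛-cancelˡ` rests on this.
⊛-cong-≤ : ∀ f {s t} k → (∀ {i} → i ≤ k → s i ≡ t i) → (f ⊛ s) k ≡ (f ⊛ t) k
⊛-cong-≤ []      k       e = refl
⊛-cong-≤ (a ∷ f) zero    e = cong (λ b → (a ∧ b) xor false) (e z≤n)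
⊛-cong-≤ (a ∷ f) (suc k) e =
  cong₂ _xor_ (cong (a ∧_) (e ≤-refl)) (⊛-cong-≤ f k (λ i≤k → e (m≤n⇒m≤1+n i≤k)))

⊛-cong : ∀ f {s t} → s ≗ t → f ⊛ s ≗ f ⊛ t
⊛-cong f e k = ⊛-cong-≤ f k (λ {i} _ → e i)

xor-interchange : ∀ a b c d → (a xor b) xor (c xor d) ≡ (a xor c) xor (b xor d)
xor-interchange = solve 4 (λ a b c d → (a :+ b) :+ (c :+ d) := (a :+ c) :+ (b :+ d)) refl

⊛-distribˡ-⊞ : ∀ f s t → f ⊛ (s ⊞ t) ≗ f ⊛ s ⊞ f ⊛ t
⊛-distribˡ-⊞ []      s t k = refl
⊛-distribˡ-⊞ (a ∷ f) s t k = trans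
  (cong₂ _xor_ (∧-distribˡ-xor a (s k) (t k))
    (trans (shift-cong 1 (⊛-distribˡ-⊞ f s t) k) (shift-⊞ 1 (f ⊛ s) (f ⊛ t) k)))
  (xor-interchange (a ∧ s k) (a ∧ t k) (shift 1 (f ⊛ s) k) (shift 1 (f ⊛ t) k))

⊛-distribʳ-⊕ : ∀ s f g → (f ⊕ g) ⊛ s ≗ f ⊛ s ⊞ g ⊛ s
⊛-distribʳ-⊕ s []      g       k = refl
⊛-distribʳ-⊕ s (a ∷ f) []      k = sym (xor-identityʳ _)
⊛-distribʳ-⊕ s (a ∷ f) (b ∷ g) k = trans
  (cong (((a xor b) ∧ s k) xor_)
    (trans (shift-cong 1 (⊛-distribʳ-⊕ s f g) k) (shift-⊞ 1 (f ⊛ s) (g ⊛ s) k)))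
  (solve 5 (λ a b c d e → (a :+ b) :* c :+ (d :+ e) := (a :* c :+ d) :+ (b :* c :+ e)) refl
    a b (s k) (shift 1 (f ⊛ s) k) (shift 1 (g ⊛ s) k))

shift-1-∧ : ∀ a s k → shift 1 (λ j → a ∧ s j) k ≡ a ∧ shift 1 s k
shift-1-∧ a s zero    = sym (∧-zeroʳ a)
shift-1-∧ a s (suc k) = refl

⊛-shift-1 : ∀ f s → f ⊛ shift 1 s ≗ shift 1 (f ⊛ s)
⊛-shift-1 []      s zero    = refl
⊛-shift-1 []      s (suc k) = refl
⊛-shift-1 (a ∷ f) s k = begin
  (a ∧ shift 1 s k) xor shift 1 (f ⊛ shift 1 s) k
    ≡⟨ cong₂ _xor_ (sym (shift-1-∧ a s k)) (shift-cong 1 (⊛-shift-1 f s) k) ⟩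
  shift 1 (λ j → a ∧ s j) k xor shift 1 (shift 1 (f ⊛ s)) k
    ≡⟨ shift-⊞ 1 (λ j → a ∧ s j) (shift 1 (f ⊛ s)) k ⟨
  shift 1 ((a ∷ f) ⊛ s) k ∎
  where open ≡-Reasoning

⊛-shift : ∀ n f s → f ⊛ shift n s ≗ shift n (f ⊛ s)
⊛-shift zero    f s k = refl
⊛-shift (suc n) f s k = begin
  (f ⊛ shift (1 + n) s) k       ≡⟨ ⊛-cong f (shift-shift 1 n s) k ⟨
  (f ⊛ shift 1 (shift n s)) k   ≡⟨ ⊛-shift-1 f (shift n s) k ⟩
  shift 1 (f ⊛ shift n s) k     ≡⟨ shift-cong 1 (⊛-shift n f s) k ⟩
  shift 1 (shift n (f ⊛ s)) k   ≡⟨ shift-shift 1 n (f ⊛ s) k ⟩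
  shift (1 + n) (f ⊛ s) k       ∎
  where open ≡-Reasoning

X^-⊛ : ∀ n s → X^ n ⊛ s ≗ shift n s
X^-⊛ zero    s zero    = xor-identityʳ _
X^-⊛ zero    s (suc k) = xor-identityʳ _
X^-⊛ (suc n) s k = trans (shift-cong 1 (X^-⊛ n s) k) (shift-shift 1 n s k)

-- With constant term 1, each coefficient of s can be recovered from the product and the earlier
-- coefficients of s, so strong induction on the index applies.
⊛-cancelˡ : ∀ f {s t} → coeff f 0 ≡ true → f ⊛ s ≗ f ⊛ t → s ≗ t
⊛-cancelˡ (true ∷ f) {s} {t} refl e k = agree (suc k) ≤-refl
  where
  open ≡-Reasoning
  -- In characteristic 2, adding the tail of the product once more removes it.
  solve-for-head : ∀ s k → s k ≡ ((true ∷ f) ⊛ s) k xor shift 1 (f ⊛ s) k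
  solve-for-head s k =
    solve 2 (λ a b → a := (con true :* a :+ b) :+ b) refl (s k) (shift 1 (f ⊛ s) k)

  agree : ∀ n {i} → i < n → s i ≡ t i
  agree (suc n) {i} (s≤s i≤n) = begin
    s i                                            ≡⟨ solve-for-head s i ⟩
    ((true ∷ f) ⊛ s) i xor shift 1 (f ⊛ s) i       ≡⟨ cong₂ _xor_ (e i) (tails i i≤n) ⟩
    ((true ∷ f) ⊛ t) i xor shift 1 (f ⊛ t) i       ≡⟨ solve-for-head t i ⟨
    t i                                            ∎
    where
    tails : ∀ i → i ≤ n → shift 1 (f ⊛ s) i ≡ shift 1 (f ⊛ t) i
    tails zero    _   = refl
    tails (suc i) i<n = ⊛-cong-≤ f i (λ j≤i → agree n (≤-trans (s≤s j≤i) i<n))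

-- Periods of a series.

Period : Series → ℕ → Set
Period s d = ∀ k → s (d + k) ≡ s k

Period-* : ∀ {s d} m → Period s d → Period s (m * d)
Period-* {s} {d} zero    per k = refl
Period-* {s} {d} (suc m) per k =
  trans (cong s (+-assoc d (m * d) k)) (trans (per (m * d + k)) (Period-* m per k))

-- The Euclidean step that later forces the least period to divide every other period.
Period-% : ∀ {s d} n .{{_ : NonZero d}} → Period s n → Period s d → Period s (n % d)
Period-% {s} {d} n pern perd k = begin
  s (n % d + k)                   ≡⟨ Period-* (n / d) perd (n % d + k) ⟨
  s (n / d * d + (n % d + k))     ≡⟨ cong s (+-assoc (n / d * d) (n % d) k) ⟨
  s (n / d * d + n % d + k)       ≡⟨ cong (λ m → s (m + k)) (+-comm (n / d * d) (n % d)) ⟩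
  s (n % d + n / d * d + k)       ≡⟨ cong (λ m → s (m + k)) (m≡m%n+[m/n]*n n d) ⟨
  s (n + k)                       ≡⟨ pern k ⟩
  s k                             ∎
  where open ≡-Reasoning

-- A known period n reduces the test to the finitely many indices below n, which makes a search for
-- the least period possible.
Period? : ∀ {s} n .{{_ : NonZero n}} → Period s n → ∀ d → Dec (Period s d)
Period? {s} n per d = map′ extend (λ p {k} _ → p k) (allUpTo? (λ k → s (d + k) Bool.≟ s k) n)
  where
  open ≡-Reasoning
  extend : (∀ {k} → k < n → s (d + k) ≡ s k) → Period s d
  extend p k = begin
    s (d + k)                       ≡⟨ cong (λ j → s (d + j)) k≡ ⟩
    s (d + (k / n * n + k % n))     ≡⟨ cong s (+-comm d (k / n * n + k % n)) ⟩
    s (k / n * n + k % n + d)       ≡⟨ cong s (+-assoc (k / n * n) (k % n) d) ⟩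
    s (k / n * n + (k % n + d))     ≡⟨ Period-* (k / n) per (k % n + d) ⟩
    s (k % n + d)                   ≡⟨ cong s (+-comm (k % n) d) ⟩
    s (d + k % n)                   ≡⟨ p (m%n<n k n) ⟩
    s (k % n)                       ≡⟨ Period-* (k / n) per (k % n) ⟨
    s (k / n * n + k % n)           ≡⟨ cong s k≡ ⟨
    s k                             ∎
    where
    k≡ : k ≡ k / n * n + k % n
    k≡ = trans (m≡m%n+[m/n]*n k n) (+-comm (k % n) (k / n * n))

-- Divisors of 1 + x^d and periods of 1/f.

coeff-applyUpTo-< : ∀ s {n k} → k < n → coeff (applyUpTo s n) k ≡ s k
coeff-applyUpTo-< s {suc n} {zero}  _         = refl
coeff-applyUpTo-< s {suc n} {suc k} (s<s k<n) = coeff-applyUpTo-< (s ∘ suc) k<n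

coeff-applyUpTo-≥ : ∀ s n k → coeff (applyUpTo s n) (n + k) ≡ false
coeff-applyUpTo-≥ s zero    k = refl
coeff-applyUpTo-≥ s (suc n) k = coeff-applyUpTo-≥ (s ∘ suc) n k

⊞-shift-< : ∀ s {d k} → k < d → (s ⊞ shift d s) k ≡ s k
⊞-shift-< s {d} {k} k<d = trans (cong (s k xor_) (shift-< s k<d)) (xor-identityʳ (s k))

xor≡false⇒≡ : ∀ {a b} → a xor b ≡ false → a ≡ b
xor≡false⇒≡ {false} {false} _ = refl
xor≡false⇒≡ {true}  {true}  _ = refl

-- Periodicity of the power series 1/f decides which 1 + xᵈ the polynomial f divides.
module Reciprocal
  (f : 𝔽₂[x]) (f₀ : coeff f 0 ≡ true) (s : Series) (f⊛s : f ⊛ s ≗ coeff 𝟙) where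

  f⊛[s⊞shift] : ∀ d → f ⊛ (s ⊞ shift d s) ≗ coeff (𝟙 ⊕ X^ d)
  f⊛[s⊞shift] d k = begin
    (f ⊛ (s ⊞ shift d s)) k               ≡⟨ ⊛-distribˡ-⊞ f s (shift d s) k ⟩
    (f ⊛ s) k xor (f ⊛ shift d s) k       ≡⟨ cong₂ _xor_ (f⊛s k) (trans (⊛-shift d f s k) (shift-cong d f⊛s k)) ⟩
    coeff 𝟙 k xor shift d (coeff 𝟙) k     ≡⟨ coeff-1⊕X^ d k ⟨
    coeff (𝟙 ⊕ X^ d) k                    ∎
    where open ≡-Reasoning

  -- Cancelling f leaves (1 + x^d)/f as the only possible cofactor. This ties the `dual` of an
  -- arbitrary `Order` to s.
  cofactor : ∀ d e → f ⊗ e ≈ 𝟙 ⊕ X^ d → coeff e ≗ s ⊞ shift d s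
  cofactor d e fe = ⊛-cancelˡ f f₀ λ k →
    trans (sym (coeff-⊗ f e k)) (trans (fe k) (sym (f⊛[s⊞shift] d k)))

  -- If d is a period, then s and x^d s agree from index d on, so (1 + x^d) s is s cut off after d
  -- terms.
  truncation : ∀ d → Period s d → f ⊗ applyUpTo s d ≈ 𝟙 ⊕ X^ d
  truncation d per k = trans (coeff-⊗ f (applyUpTo s d) k) (trans (⊛-cong f same k) (f⊛[s⊞shift] d k))
    where
    same : coeff (applyUpTo s d) ≗ s ⊞ shift d s
    same j with <-≤-connex j d
    ... | inj₁ j<d = trans (coeff-applyUpTo-< s j<d) (sym (⊞-shift-< s j<d))
    ... | inj₂ d≤j with m≤n⇒∃[o]m+o≡n d≤j
    ...   | i , refl = begin
      coeff (applyUpTo s d) (d + i)         ≡⟨ coeff-applyUpTo-≥ s d i ⟩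
      false                                 ≡⟨ xor-same (s i) ⟨
      s i xor s i                           ≡⟨ cong₂ _xor_ (per i) (shift-+ d s i) ⟨
      s (d + i) xor shift d s (d + i)       ∎
      where open ≡-Reasoning

  -- The quotient is s ⊞ shift d s, which vanishes far out; the period n moves
  -- this back to the start of s.
  divides⇒period : ∀ {d} n .{{_ : NonZero n}} → Period s n → f ∣ₚ 𝟙 ⊕ X^ d → Period s d
  divides⇒period {d} n per (e , fe) k = begin
    s (d + k)               ≡⟨ Period-* L per (d + k) ⟨
    s (L * n + (d + k))     ≡⟨ cong s swap ⟩
    s (d + (L * n + k))     ≡⟨ xor≡false⇒≡ vanishes ⟩
    s (L * n + k)           ≡⟨ Period-* L per k ⟩
    s k                     ∎
    where
    open ≡-Reasoning
    L = length e
    swap : L * n + (d + k) ≡ d + (L * n + k)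
    swap = trans (sym (+-assoc (L * n) d k))
                 (trans (cong (_+ k) (+-comm (L * n) d)) (+-assoc d (L * n) k))
    far : L ≤ d + (L * n + k)
    far = ≤-trans (m≤m*n L n) (≤-trans (m≤m+n (L * n) k) (m≤n+m (L * n + k) d))
    vanishes : s (d + (L * n + k)) xor s (L * n + k) ≡ false
    vanishes = begin
      s (d + (L * n + k)) xor s (L * n + k)           ≡⟨ cong (s (d + (L * n + k)) xor_) (shift-+ d s (L * n + k)) ⟨
      (s ⊞ shift d s) (d + (L * n + k))               ≡⟨ cofactor d e fe (d + (L * n + k)) ⟨
      coeff e (d + (L * n + k))                       ≡⟨ coeff-length e far ⟩
      false                                           ∎

  dual-coeff : ∀ d e → f ⊗ e ≈ 𝟙 ⊕ X^ d → ∀ {k} → k < d → coeff e k ≡ s k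
  dual-coeff d e fe {k} k<d = trans (cofactor d e fe k) (⊞-shift-< s k<d)

  -- The list e may carry trailing zeros beyond index d. Knowing that they are zeros lets `ℓ₁` be
  -- computed from the first d coefficients alone.
  dual-vanishes : ∀ d e → f ⊗ e ≈ 𝟙 ⊕ X^ d → Period s d → ∀ k → coeff e (d + k) ≡ false
  dual-vanishes d e fe per k = begin
    coeff e (d + k)                   ≡⟨ cofactor d e fe (d + k) ⟩
    s (d + k) xor shift d s (d + k)   ≡⟨ cong₂ _xor_ (per k) (shift-+ d s k) ⟩
    s k xor s k                       ≡⟨ xor-same (s k) ⟩
    false                             ∎
    where open ≡-Reasoning

-- The inverse series obtained from a quotient of 1 + x^n.

-- From f u = 1 + xⁿ with deg u < n one gets 1/f = u + xⁿu + x²ⁿu + ….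
periodise : ∀ n .{{_ : NonZero n}} → Series → Series
periodise n u k = u (k % n)

periodise-period : ∀ n .{{_ : NonZero n}} u → Period (periodise n u) n
periodise-period n u k = cong u (trans (cong (_% n) (+-comm n k)) ([m+n]%n≡m%n k n))

periodise-unfold : ∀ n .{{_ : NonZero n}} u → (∀ k → u (n + k) ≡ false) →
                   periodise n u ≗ u ⊞ shift n (periodise n u)
periodise-unfold n u vanish k with <-≤-connex k n
... | inj₁ k<n = trans (cong u (m<n⇒m%n≡m k<n))
                       (sym (trans (cong (u k xor_) (shift-< (periodise n u) k<n)) (xor-identityʳ (u k))))
... | inj₂ n≤k with m≤n⇒∃[o]m+o≡n n≤k
...   | i , refl = begin
  periodise n u (n + i)                         ≡⟨ periodise-period n u i ⟩
  periodise n u i                               ≡⟨ shift-+ n (periodise n u) i ⟨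
  shift n (periodise n u) (n + i)               ≡⟨ cong (_xor shift n (periodise n u) (n + i)) (vanish i) ⟨
  u (n + i) xor shift n (periodise n u) (n + i) ∎
  where open ≡-Reasoning

-- Both f s and 1 solve y = (1 + x^n) + x^n y: the first by `periodise-unfold`, the second because
-- x^n cancels. As n is positive, the equation determines each coefficient from earlier ones, so the
-- solutions coincide.
⊛-periodise : ∀ f n .{{_ : NonZero n}} {u} → (∀ k → u (n + k) ≡ false) →
              f ⊛ u ≗ coeff 𝟙 ⊞ shift n (coeff 𝟙) → f ⊛ periodise n u ≗ coeff 𝟙
⊛-periodise f n {u} vanish fu = λ k → agree (suc k) ≤-refl
  where
  open ≡-Reasoning
  s = periodise n u

  unfold : f ⊛ s ≗ f ⊛ u ⊞ shift n (f ⊛ s)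
  unfold k = begin
    (f ⊛ s) k                         ≡⟨ ⊛-cong f (periodise-unfold n u vanish) k ⟩
    (f ⊛ (u ⊞ shift n s)) k           ≡⟨ ⊛-distribˡ-⊞ f u (shift n s) k ⟩
    (f ⊛ u) k xor (f ⊛ shift n s) k   ≡⟨ cong ((f ⊛ u) k xor_) (⊛-shift n f s k) ⟩
    (f ⊛ u) k xor shift n (f ⊛ s) k   ∎

  agree : ∀ m {k} → k < m → (f ⊛ s) k ≡ coeff 𝟙 k
  agree (suc m) {k} (s≤s k≤m) = begin
    (f ⊛ s) k                                                     ≡⟨ unfold k ⟩
    (f ⊛ u) k xor shift n (f ⊛ s) k                               ≡⟨ cong₂ _xor_ (fu k) tails ⟩
    (coeff 𝟙 k xor shift n (coeff 𝟙) k) xor shift n (coeff 𝟙) k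
      ≡⟨ solve 2 (λ a b → (a :+ b) :+ b := a) refl (coeff 𝟙 k) (shift n (coeff 𝟙) k) ⟩
    coeff 𝟙 k ∎
    where
    tails : shift n (f ⊛ s) k ≡ shift n (coeff 𝟙) k
    tails with <-≤-connex k n
    ... | inj₁ k<n = trans (shift-< (f ⊛ s) k<n) (sym (shift-< (coeff 𝟙) k<n))
    ... | inj₂ n≤k with m≤n⇒∃[o]m+o≡n n≤k
    ...   | i , refl = begin
      shift n (f ⊛ s) (n + i)       ≡⟨ shift-+ n (f ⊛ s) i ⟩
      (f ⊛ s) i                     ≡⟨ agree m (≤-trans (m<n+m i (>-nonZero⁻¹ n)) k≤m) ⟩
      coeff 𝟙 i                     ≡⟨ shift-+ n (coeff 𝟙) i ⟨
      shift n (coeff 𝟙) (n + i)     ∎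

-- Pascal's triangle modulo 2.

shift-comm : ∀ m n s → shift m (shift n s) ≗ shift n (shift m s)
shift-comm m n s k = trans (shift-shift m n s k)
  (trans (cong (λ i → shift i s k) (+-comm m n)) (sym (shift-shift n m s k)))

-- row a b is the binomial coefficient C(a,b) modulo 2.
row : ℕ → Series
row zero    = coeff 𝟙
row (suc a) = row a ⊞ shift 1 (row a)

row-0 : ∀ a → row a 0 ≡ true
row-0 zero    = refl
row-0 (suc a) = trans (xor-identityʳ (row a 0)) (row-0 a)

row-> : ∀ {a b} → a < b → row a b ≡ false
row-> {zero}  {suc b} _         = refl
row-> {suc a} {suc b} (s<s a<b) = cong₂ _xor_ (row-> (m<n⇒m<1+n a<b)) (row-> a<b)

-- (1 + y)^q = 1 + y^q in 𝔽₂[y]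
Frobenius : ℕ → Set
Frobenius q = row q ≗ coeff 𝟙 ⊞ shift q (coeff 𝟙)

-- This is (1 + y)^(a+q) = (1 + y)^a (1 + y^q). Each step of the induction multiplies both sides by
-- 1 + y, which commutes with multiplication by y^q.
row-+ : ∀ {q} → Frobenius q → ∀ a → row (a + q) ≗ row a ⊞ shift q (row a)
row-+ frob zero    = frob
row-+ {q} frob (suc a) k = begin
  row (a + q) k xor shift 1 (row (a + q)) k
    ≡⟨ cong₂ _xor_ (row-+ frob a k) (shift-cong 1 (row-+ frob a) k) ⟩
  (row a k xor shift q (row a) k) xor shift 1 (row a ⊞ shift q (row a)) k
    ≡⟨ cong ((row a ⊞ shift q (row a)) k xor_) (shift-⊞ 1 (row a) (shift q (row a)) k) ⟩
  (row a k xor shift q (row a) k) xor (shift 1 (row a) k xor shift 1 (shift q (row a)) k)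
    ≡⟨ xor-interchange (row a k) (shift q (row a) k) (shift 1 (row a) k) (shift 1 (shift q (row a)) k) ⟩
  row (suc a) k xor (shift q (row a) k xor shift 1 (shift q (row a)) k)
    ≡⟨ cong (λ x → row (suc a) k xor (shift q (row a) k xor x)) (shift-comm 1 q (row a) k) ⟩
  row (suc a) k xor (shift q (row a) k xor shift q (shift 1 (row a)) k)
    ≡⟨ cong (row (suc a) k xor_) (shift-⊞ q (row a) (shift 1 (row a)) k) ⟨
  row (suc a) k xor shift q (row (suc a)) k ∎
  where open ≡-Reasoning

-- Squaring 1 + y^q produces the middle term twice, and it cancels.
frobenius-double : ∀ {q} → Frobenius q → Frobenius (q + q)
frobenius-double {q} frob k = begin
  row (q + q) k
    ≡⟨ row-+ frob q k ⟩
  row q k xor shift q (row q) k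
    ≡⟨ cong₂ _xor_ (frob k) (trans (shift-cong q frob k) (shift-⊞ q (coeff 𝟙) (shift q (coeff 𝟙)) k)) ⟩
  (coeff 𝟙 k xor shift q (coeff 𝟙) k) xor (shift q (coeff 𝟙) k xor shift q (shift q (coeff 𝟙)) k)
    ≡⟨ solve 3 (λ a b c → (a :+ b) :+ (b :+ c) := a :+ c) refl (coeff 𝟙 k) (shift q (coeff 𝟙) k) _ ⟩
  coeff 𝟙 k xor shift q (shift q (coeff 𝟙)) k
    ≡⟨ cong (coeff 𝟙 k xor_) (shift-shift q q (coeff 𝟙) k) ⟩
  coeff 𝟙 k xor shift (q + q) (coeff 𝟙) k ∎
  where open ≡-Reasoning

frobenius-2^ : ∀ r → Frobenius (2 ^ r)
frobenius-2^ zero    k = refl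
frobenius-2^ (suc r) = subst Frobenius (cong (2 ^ r +_) (sym (+-identityʳ (2 ^ r))))
  (frobenius-double {2 ^ r} (frobenius-2^ r))

<⇒<ᵇ≡true : ∀ {m n} → m < n → (m <ᵇ n) ≡ true
<⇒<ᵇ≡true z<s               = refl
<⇒<ᵇ≡true (s<s m<n@(s≤s _)) = <⇒<ᵇ≡true m<n

≥⇒<ᵇ≡false : ∀ {m n} → n ≤ m → (m <ᵇ n) ≡ false
≥⇒<ᵇ≡false z≤n       = refl
≥⇒<ᵇ≡false (s≤s n≤m) = ≥⇒<ᵇ≡false n≤m

-- Multiplying `row a` by 1 + y gives 1 + y^q, whose coefficients strictly between 0 and q vanish.
-- Neighbouring entries of `row a` below q are therefore equal, and the first one is 1.
row-pred : ∀ {q a} → Frobenius q → suc a ≡ q → ∀ b → row a b ≡ (b <ᵇ q)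
row-pred {q} {a} frob refl b with <-≤-connex b q
... | inj₂ q≤b = trans (row-> q≤b) (sym (≥⇒<ᵇ≡false q≤b))
... | inj₁ b<q = trans (ones b b<q) (sym (<⇒<ᵇ≡true b<q))
  where
  ones : ∀ b → b < q → row a b ≡ true
  ones zero    _   = row-0 a
  ones (suc b) b<q = trans
    (xor≡false⇒≡ (trans (frob (suc b)) (shift-< (coeff 𝟙) b<q)))
    (ones b (<-trans (n<1+n b) b<q))

-- Series indexed by base-q digits.

coeff-𝟙-> : ∀ {n} → 0 < n → coeff 𝟙 n ≡ false
coeff-𝟙-> z<s = refl

-- With y = x^q this is the sum over a < q of x^a times the series `F a` in y. Only the digit a is
-- bounded.
grid : ∀ q .{{_ : NonZero q}} → (ℕ → ℕ → Bool) → Series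
grid q F k = F (k % q) (k / q)

module _ (q : ℕ) {{_ : NonZero q}} where

  grid-eval : ∀ F {a} b → a < q → grid q F (a + b * q) ≡ F a b
  grid-eval F {a} b a<q = cong₂ F
    (trans ([m+kn]%n≡m%n a b q) (m<n⇒m%n≡m a<q))
    (trans (+-distrib-/-∣ʳ a (n∣m*n b)) (cong₂ _+_ (m<n⇒m/n≡0 a<q) (m*n/n≡m b q)))

  grid-ind : ∀ {p} (P : ℕ → Set p) → (∀ a b → a < q → P (a + b * q)) → ∀ k → P k
  grid-ind P h k = subst P (sym (m≡m%n+[m/n]*n k q)) (h (k % q) (k / q) (m%n<n k q))

  -- Multiplication by x^(nq) = y^n touches only the y-part, hence acts on each `F a` separately.
  shift-grid : ∀ n F {a} b → a < q → shift (n * q) (grid q F) (a + b * q) ≡ shift n (F a) b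
  shift-grid n F {a} b a<q with <-≤-connex b n
  ... | inj₁ b<n = trans (shift-< (grid q F) below) (sym (shift-< (F a) b<n))
    where
    below : a + b * q < n * q
    below = <-≤-trans (+-monoˡ-< (b * q) a<q) (*-monoˡ-≤ q b<n)
  ... | inj₂ n≤b with m≤n⇒∃[o]m+o≡n n≤b
  ...   | c , refl = begin
    shift (n * q) (grid q F) (a + (n + c) * q)        ≡⟨ cong (shift (n * q) (grid q F)) arg ⟩
    shift (n * q) (grid q F) (n * q + (a + c * q))    ≡⟨ shift-+ (n * q) (grid q F) (a + c * q) ⟩
    grid q F (a + c * q)                              ≡⟨ grid-eval F c a<q ⟩
    F a c                                             ≡⟨ shift-+ n (F a) c ⟨
    shift n (F a) (n + c)                             ∎
    where
    open ≡-Reasoning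
    arg : a + (n + c) * q ≡ n * q + (a + c * q)
    arg = begin
      a + (n + c) * q         ≡⟨ cong (a +_) (*-distribʳ-+ q n c) ⟩
      a + (n * q + c * q)     ≡⟨ +-assoc a (n * q) (c * q) ⟨
      a + n * q + c * q       ≡⟨ cong (_+ c * q) (+-comm a (n * q)) ⟩
      n * q + a + c * q       ≡⟨ +-assoc (n * q) a (c * q) ⟩
      n * q + (a + c * q)     ∎

  coeff-𝟙-grid : coeff 𝟙 ≗ grid q (λ a b → coeff 𝟙 a ∧ coeff 𝟙 b)
  coeff-𝟙-grid = grid-ind _ λ a b a<q →
    trans (split a b) (sym (grid-eval (λ a b → coeff 𝟙 a ∧ coeff 𝟙 b) b a<q))
    where
    split : ∀ a b → coeff 𝟙 (a + b * q) ≡ coeff 𝟙 a ∧ coeff 𝟙 b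
    split (suc a) b       = refl
    split zero    zero    = refl
    split zero    (suc b) = coeff-𝟙-> (<-≤-trans (>-nonZero⁻¹ q) (m≤m+n q (b * q)))

  shift-𝟙-grid : ∀ n {a} b → a < q →
                 shift (n * q) (coeff 𝟙) (a + b * q) ≡ shift n (λ b → coeff 𝟙 a ∧ coeff 𝟙 b) b
  shift-𝟙-grid n {a} b a<q = trans (shift-cong (n * q) coeff-𝟙-grid (a + b * q)) (shift-grid n _ b a<q)

shift-false : ∀ n k → shift n (λ _ → false) k ≡ false
shift-false zero    k       = refl
shift-false (suc n) zero    = refl
shift-false (suc n) (suc k) = shift-false n k

-- The explicit quotient of 1 + x^N by f.

module PartialInverse (q : ℕ) {{_ : NonZero q}} (frob : Frobenius q) where

  -- Stands for t^(q-1): the slice `row a` is (1 + y)^a with y = x^q. `trinomial-power` confirms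
  -- this in the form t · `power` = t^q.
  power : Series
  power = grid q row

  -- Without the cut-off at b = q the negated binomial would stay 1 for all large b, since C(a,b+1)
  -- = 0 there. The cut makes u a polynomial.
  u-entry : ℕ → ℕ → Bool
  u-entry a b = (b <ᵇ q) ∧ not (row a (suc b))

  u : Series
  u = grid q u-entry

  -- One more than (q + 1) q, the top exponent of t^q, because t^q enters as x t^q.
  period : ℕ
  period = suc (suc q * q)

  private
    0<q : 0 < q
    0<q = >-nonZero⁻¹ q

    next-row : ∀ {a} b → suc a ≡ q → suc (a + b * q) ≡ suc b * q
    next-row b eq = cong (_+ b * q) eq

    shift-q-grid : ∀ F {a} b → a < q → shift q (grid q F) (a + b * q) ≡ shift 1 (F a) b
    shift-q-grid F {a} b a<q =
      subst (λ m → shift m (grid q F) (a + b * q) ≡ shift 1 (F a) b) (*-identityˡ q) (shift-grid q 1 F b a<q)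

    shift-q-𝟙 : ∀ {a} b → a < q → shift q (coeff 𝟙) (a + b * q) ≡ shift 1 (λ b → coeff 𝟙 a ∧ coeff 𝟙 b) b
    shift-q-𝟙 {a} b a<q =
      subst (λ m → shift m (coeff 𝟙) (a + b * q) ≡ shift 1 (λ b → coeff 𝟙 a ∧ coeff 𝟙 b) b)
        (*-identityˡ q) (shift-𝟙-grid q 1 b a<q)

  -- The coefficients of (1 + x + x^(q+1)) (1 + x + x^(q+1))^(q-1), by Pascal's rule
  -- inside a row and by frob at its end.
  trinomial-power : power ⊞ shift 1 power ⊞ shift (suc q) power ≗
                coeff 𝟙 ⊞ shift q (coeff 𝟙) ⊞ shift (suc q * q) (coeff 𝟙)
  trinomial-power zero = begin
    (power 0 xor false) xor false    ≡⟨ cong (λ x → (x xor false) xor false) (grid-eval q row 0 0<q) ⟩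
    true                         ≡⟨ cong₂ (λ x y → (true xor x) xor y) (shift-< (coeff 𝟙) 0<q)
                                          (shift-< (coeff 𝟙) (<-≤-trans 0<q (m≤m+n q (q * q)))) ⟨
    (true xor shift q (coeff 𝟙) 0) xor shift (suc q * q) (coeff 𝟙) 0 ∎
    where open ≡-Reasoning
  trinomial-power (suc k) = grid-ind q
    (λ k → (power ⊞ shift 1 power ⊞ shift (suc q) power) (suc k) ≡
           (coeff 𝟙 ⊞ shift q (coeff 𝟙) ⊞ shift (suc q * q) (coeff 𝟙)) (suc k))
    step k
    where
    open ≡-Reasoning
    step : ∀ a b → a < q → (power ⊞ shift 1 power ⊞ shift (suc q) power) (suc (a + b * q)) ≡
           (coeff 𝟙 ⊞ shift q (coeff 𝟙) ⊞ shift (suc q * q) (coeff 𝟙)) (suc (a + b * q))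
    step a b a<q with m≤n⇒m<n∨m≡n a<q
    ... | inj₁ a+1<q = begin
      (power (suc a + b * q) xor power (a + b * q)) xor shift q power (a + b * q)
        ≡⟨ cong₂ _xor_ (cong₂ _xor_ (grid-eval q row b a+1<q) (grid-eval q row b a<q)) (shift-q-grid row b a<q) ⟩
      ((row a b xor shift 1 (row a) b) xor row a b) xor shift 1 (row a) b
        ≡⟨ solve 2 (λ x y → ((x :+ y) :+ x) :+ y := con false) refl (row a b) (shift 1 (row a) b) ⟩
      false
        ≡⟨ cong₂ _xor_ (trans (shift-q-𝟙 b a+1<q) (shift-false 1 b))
                       (trans (shift-𝟙-grid q (suc q) b a+1<q) (shift-false (suc q) b)) ⟨
      shift q (coeff 𝟙) (suc a + b * q) xor shift (suc q * q) (coeff 𝟙) (suc a + b * q) ∎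
    ... | inj₂ a+1≡q = begin
      (power (suc (a + b * q)) xor power (a + b * q)) xor shift q power (a + b * q)
        ≡⟨ cong₂ _xor_
             (cong₂ _xor_ (trans (cong power (next-row b a+1≡q)) (grid-eval q row (suc b) 0<q))
                          (grid-eval q row b a<q))
             (shift-q-grid row b a<q) ⟩
      row (suc a) b
        ≡⟨ cong (λ m → row m b) a+1≡q ⟩
      row q b
        ≡⟨ frob b ⟩
      coeff 𝟙 b xor shift q (coeff 𝟙) b
        ≡⟨ cong₂ _xor_ (trans (cong (shift q (coeff 𝟙)) (next-row b a+1≡q)) (shift-q-𝟙 (suc b) 0<q))
                       (trans (cong (shift (suc q * q) (coeff 𝟙)) (next-row b a+1≡q))
                              (shift-𝟙-grid q (suc q) (suc b) 0<q)) ⟨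
      shift q (coeff 𝟙) (suc (a + b * q)) xor shift (suc q * q) (coeff 𝟙) (suc (a + b * q)) ∎

  -- While a grows with b fixed, consecutive entries differ by C(a+1,b+1) - C(a,b+1) = C(a,b). The
  -- jump from a = q - 1 to a = 0 with b + 1 uses instead that `row (q - 1)` consists of ones below
  -- q.
  [1+x]u : u ⊞ shift 1 u ≗ coeff 𝟙 ⊞ shift 1 power
  [1+x]u zero = trans (xor-identityʳ (u 0)) (trans (grid-eval q u-entry 0 0<q) (cong (_∧ true) (<⇒<ᵇ≡true 0<q)))
  [1+x]u (suc k) = grid-ind q (λ k → u (suc k) xor u k ≡ power k) step k
    where
    open ≡-Reasoning
    pascal : ∀ a b → a < q → u-entry (suc a) b xor u-entry a b ≡ row a b
    pascal a b a<q with <-≤-connex b q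
    ... | inj₁ b<q rewrite <⇒<ᵇ≡true b<q =
      solve 2 (λ x y → (con true :+ (x :+ y)) :+ (con true :+ x) := y) refl (row a (suc b)) (row a b)
    ... | inj₂ q≤b rewrite ≥⇒<ᵇ≡false q≤b = sym (row-> (<-≤-trans a<q q≤b))

    -- The factor `true` is the entry at a = 0, as `row 0` vanishes past its constant term. The
    -- second summand survives only at b = q - 1, exactly where the first one has just become zero.
    row-end : ∀ b → ((suc b <ᵇ q) ∧ true) xor ((b <ᵇ q) ∧ not (suc b <ᵇ q)) ≡ (b <ᵇ q)
    row-end b with <-≤-connex (suc b) q
    ... | inj₁ b+1<q rewrite <⇒<ᵇ≡true b+1<q | <⇒<ᵇ≡true (<-trans (n<1+n b) b+1<q) = refl
    ... | inj₂ q≤b+1 rewrite ≥⇒<ᵇ≡false q≤b+1 = ∧-identityʳ (b <ᵇ q)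

    step : ∀ a b → a < q → u (suc (a + b * q)) xor u (a + b * q) ≡ power (a + b * q)
    step a b a<q with m≤n⇒m<n∨m≡n a<q
    ... | inj₁ a+1<q = begin
      u (suc a + b * q) xor u (a + b * q)    ≡⟨ cong₂ _xor_ (grid-eval q u-entry b a+1<q) (grid-eval q u-entry b a<q) ⟩
      u-entry (suc a) b xor u-entry a b      ≡⟨ pascal a b a<q ⟩
      row a b                                ≡⟨ grid-eval q row b a<q ⟨
      power (a + b * q)                          ∎
    ... | inj₂ a+1≡q = begin
      u (suc (a + b * q)) xor u (a + b * q)
        ≡⟨ cong₂ _xor_ (trans (cong u (next-row b a+1≡q)) (grid-eval q u-entry (suc b) 0<q))
                       (grid-eval q u-entry b a<q) ⟩
      ((suc b <ᵇ q) ∧ true) xor ((b <ᵇ q) ∧ not (row a (suc b)))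
        ≡⟨ cong (λ x → ((suc b <ᵇ q) ∧ true) xor ((b <ᵇ q) ∧ not x)) (row-pred frob a+1≡q (suc b)) ⟩
      ((suc b <ᵇ q) ∧ true) xor ((b <ᵇ q) ∧ not (suc b <ᵇ q))
        ≡⟨ row-end b ⟩
      (b <ᵇ q)
        ≡⟨ row-pred frob a+1≡q b ⟨
      row a b
        ≡⟨ grid-eval q row b a<q ⟨
      power (a + b * q) ∎

  -- 1 + x² + x^(q+1) + x^(q+2) = (1 + x)(1 + x + x^(q+1))
  ⊛-u : (𝟙 ⊕ X^ 2 ⊕ X^ (q + 1) ⊕ X^ (q + 2)) ⊛ u ≗ coeff 𝟙 ⊞ shift period (coeff 𝟙)
  ⊛-u k = begin
    ((𝟙 ⊕ X^ 2 ⊕ X^ (q + 1) ⊕ X^ (q + 2)) ⊛ u) k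
      ≡⟨ expand ⟩
    ((u k xor shift 2 u k) xor shift (1 + q) u k) xor shift (2 + q) u k
      ≡⟨ solve 5 (λ a b c d e → ((a :+ c) :+ d) :+ e := ((a :+ b) :+ (b :+ c)) :+ (d :+ e)) refl
           (u k) (shift 1 u k) (shift 2 u k) (shift (1 + q) u k) (shift (2 + q) u k) ⟩
    ((u k xor shift 1 u k) xor (shift 1 u k xor shift 2 u k)) xor (shift (1 + q) u k xor shift (2 + q) u k)
      ≡⟨ cong₂ _xor_ (cong₂ _xor_ ([1+x]u k) (shifted 1)) (shifted (1 + q)) ⟩
    ((δ 0 xor shift 1 power k) xor (δ 1 xor shift 2 power k)) xor (δ (1 + q) xor shift (2 + q) power k)
      ≡⟨ solve 6 (λ a b c d e f → ((a :+ b) :+ (c :+ d)) :+ (e :+ f) := (a :+ (c :+ e)) :+ ((b :+ d) :+ f)) refl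
           (δ 0) (shift 1 power k) (δ 1) (shift 2 power k) (δ (1 + q)) (shift (2 + q) power k) ⟩
    (δ 0 xor (δ 1 xor δ (1 + q))) xor ((shift 1 power k xor shift 2 power k) xor shift (2 + q) power k)
      ≡⟨ cong ((δ 0 xor (δ 1 xor δ (1 + q))) xor_) trinomial ⟩
    (δ 0 xor (δ 1 xor δ (1 + q))) xor ((δ 1 xor δ (1 + q)) xor δ period)
      ≡⟨ solve 3 (λ a b c → (a :+ b) :+ (b :+ c) := a :+ c) refl (δ 0) (δ 1 xor δ (1 + q)) (δ period) ⟩
    δ 0 xor δ period ∎
    where
    open ≡-Reasoning
    δ : ℕ → Bool
    δ n = shift n (coeff 𝟙) k

    expand : ((𝟙 ⊕ X^ 2 ⊕ X^ (q + 1) ⊕ X^ (q + 2)) ⊛ u) k ≡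
             ((u k xor shift 2 u k) xor shift (1 + q) u k) xor shift (2 + q) u k
    expand = trans (⊛-distribʳ-⊕ u (𝟙 ⊕ X^ 2 ⊕ X^ (q + 1)) (X^ (q + 2)) k) (cong₂ _xor_
      (trans (⊛-distribʳ-⊕ u (𝟙 ⊕ X^ 2) (X^ (q + 1)) k) (cong₂ _xor_
        (trans (⊛-distribʳ-⊕ u 𝟙 (X^ 2) k) (cong₂ _xor_ (X^-⊛ 0 u k) (X^-⊛ 2 u k)))
        (trans (X^-⊛ (q + 1) u k) (cong (λ n → shift n u k) (+-comm q 1)))))
      (trans (X^-⊛ (q + 2) u k) (cong (λ n → shift n u k) (+-comm q 2))))

    shift-suc : ∀ n s → shift n (shift 1 s) k ≡ shift (suc n) s k
    shift-suc n s = trans (shift-comm n 1 s k) (shift-shift 1 n s k)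

    shifted : ∀ n → shift n u k xor shift (suc n) u k ≡ δ n xor shift (suc n) power k
    shifted n = begin
      shift n u k xor shift (suc n) u k           ≡⟨ cong (shift n u k xor_) (shift-suc n u) ⟨
      shift n u k xor shift n (shift 1 u) k       ≡⟨ shift-⊞ n u (shift 1 u) k ⟨
      shift n (u ⊞ shift 1 u) k                   ≡⟨ shift-cong n [1+x]u k ⟩
      shift n (coeff 𝟙 ⊞ shift 1 power) k             ≡⟨ shift-⊞ n (coeff 𝟙) (shift 1 power) k ⟩
      δ n xor shift n (shift 1 power) k               ≡⟨ cong (δ n xor_) (shift-suc n power) ⟩
      δ n xor shift (suc n) power k                   ∎

    shift-⊞₃ : ∀ s t v → shift 1 (s ⊞ t ⊞ v) k ≡ (shift 1 s k xor shift 1 t k) xor shift 1 v k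
    shift-⊞₃ s t v = trans (shift-⊞ 1 (s ⊞ t) v k) (cong (_xor shift 1 v k) (shift-⊞ 1 s t k))

    trinomial : (shift 1 power k xor shift 2 power k) xor shift (2 + q) power k ≡ (δ 1 xor δ (1 + q)) xor δ period
    trinomial = begin
      (shift 1 power k xor shift 2 power k) xor shift (2 + q) power k
        ≡⟨ cong₂ (λ x y → (shift 1 power k xor x) xor y) (shift-shift 1 1 power k) (shift-shift 1 (suc q) power k) ⟨
      (shift 1 power k xor shift 1 (shift 1 power) k) xor shift 1 (shift (suc q) power) k
        ≡⟨ shift-⊞₃ power (shift 1 power) (shift (suc q) power) ⟨
      shift 1 (power ⊞ shift 1 power ⊞ shift (suc q) power) k
        ≡⟨ shift-cong 1 trinomial-power k ⟩
      shift 1 (coeff 𝟙 ⊞ shift q (coeff 𝟙) ⊞ shift (suc q * q) (coeff 𝟙)) k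
        ≡⟨ shift-⊞₃ (coeff 𝟙) (shift q (coeff 𝟙)) (shift (suc q * q) (coeff 𝟙)) ⟩
      (δ 1 xor shift 1 (shift q (coeff 𝟙)) k) xor shift 1 (shift (suc q * q) (coeff 𝟙)) k
        ≡⟨ cong₂ (λ x y → (δ 1 xor x) xor y) (shift-shift 1 q (coeff 𝟙) k) (shift-shift 1 (suc q * q) (coeff 𝟙) k) ⟩
      (δ 1 xor δ (1 + q)) xor δ period ∎

  u-vanishes : ∀ k → u (q * q + k) ≡ false
  u-vanishes k = cong (_∧ not (row ((q * q + k) % q) (suc ((q * q + k) / q)))) (≥⇒<ᵇ≡false q≤)
    where
    q≤ : q ≤ (q * q + k) / q
    q≤ = subst (_≤ (q * q + k) / q) (m*n/n≡m q q) (/-monoˡ-≤ q (m≤m+n (q * q) k))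

-- Counting coefficients by finite sums.

Σ< : ℕ → (ℕ → ℕ) → ℕ
Σ< zero    f = 0
Σ< (suc n) f = f 0 + Σ< n (f ∘ suc)

ind : Bool → ℕ
ind true  = 1
ind false = 0

Σ<-cong : ∀ n {f g} → (∀ {k} → k < n → f k ≡ g k) → Σ< n f ≡ Σ< n g
Σ<-cong zero    e = refl
Σ<-cong (suc n) e = cong₂ _+_ (e z<s) (Σ<-cong n (e ∘ s<s))

Σ<-const : ∀ n {f c} → (∀ {k} → k < n → f k ≡ c) → Σ< n f ≡ n * c
Σ<-const zero    e = refl
Σ<-const (suc n) e = cong₂ _+_ (e z<s) (Σ<-const n (e ∘ s<s))

Σ<-zero : ∀ n {f} → (∀ {k} → k < n → f k ≡ 0) → Σ< n f ≡ 0
Σ<-zero n e = trans (Σ<-const n e) (*-zeroʳ n)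

Σ<-split : ∀ m n f → Σ< (m + n) f ≡ Σ< m f + Σ< n (f ∘ (m +_))
Σ<-split zero    n f = refl
Σ<-split (suc m) n f = trans (cong (f 0 +_) (Σ<-split m n (f ∘ suc)))
                             (sym (+-assoc (f 0) (Σ< m (f ∘ suc)) (Σ< n (f ∘ (suc m +_)))))

Σ<-+ : ∀ n f g → Σ< n (λ k → f k + g k) ≡ Σ< n f + Σ< n g
Σ<-+ zero    f g = refl
Σ<-+ (suc n) f g = trans (cong (f 0 + g 0 +_) (Σ<-+ n (f ∘ suc) (g ∘ suc)))
                         (lemma (f 0) (g 0) (Σ< n (f ∘ suc)) (Σ< n (g ∘ suc)))
  where
  lemma : ∀ a b c d → a + b + (c + d) ≡ a + c + (b + d)
  lemma = solve-∀

Σ<-suc-last : ∀ n f → Σ< (suc n) f ≡ Σ< n f + f n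
Σ<-suc-last zero    f = +-identityʳ (f 0)
Σ<-suc-last (suc n) f = trans (cong (f 0 +_) (Σ<-suc-last n (f ∘ suc)))
                              (sym (+-assoc (f 0) (Σ< n (f ∘ suc)) (f (suc n))))

Σ<-period : ∀ m n f → (∀ k → f (n + k) ≡ f k) → Σ< (m * n) f ≡ m * Σ< n f
Σ<-period zero    n f per = refl
Σ<-period (suc m) n f per = begin
  Σ< (n + m * n) f                      ≡⟨ Σ<-split n (m * n) f ⟩
  Σ< n f + Σ< (m * n) (f ∘ (n +_))      ≡⟨ cong (Σ< n f +_) (Σ<-cong (m * n) (λ {k} _ → per k)) ⟩
  Σ< n f + Σ< (m * n) f                 ≡⟨ cong (Σ< n f +_) (Σ<-period m n f per) ⟩
  suc m * Σ< n f                        ∎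
  where open ≡-Reasoning

Σ<-grid : ∀ q .{{_ : NonZero q}} (φ : Bool → ℕ) n F →
          Σ< (n * q) (φ ∘ grid q F) ≡ Σ< n (λ b → Σ< q (λ a → φ (F a b)))
Σ<-grid q φ zero    F = refl
Σ<-grid q φ (suc n) F = begin
  Σ< (q + n * q) (φ ∘ grid q F)
    ≡⟨ Σ<-split q (n * q) (φ ∘ grid q F) ⟩
  Σ< q (φ ∘ grid q F) + Σ< (n * q) (λ k → φ (grid q F (q + k)))
    ≡⟨ cong₂ _+_
         (Σ<-cong q (λ k<q → cong φ (cong₂ F (m<n⇒m%n≡m k<q) (m<n⇒m/n≡0 k<q))))
         (Σ<-cong (n * q) (λ {k} _ → cong φ (next-row k))) ⟩
  Σ< q (λ a → φ (F a 0)) + Σ< (n * q) (φ ∘ grid q (λ a b → F a (suc b)))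
    ≡⟨ cong (Σ< q (λ a → φ (F a 0)) +_) (Σ<-grid q φ n (λ a b → F a (suc b))) ⟩
  Σ< (suc n) (λ b → Σ< q (λ a → φ (F a b))) ∎
  where
  open ≡-Reasoning
  next-row : ∀ k → grid q F (q + k) ≡ grid q (λ a b → F a (suc b)) k
  next-row k = cong₂ F
    (trans (cong (_% q) (+-comm q k)) ([m+n]%n≡m%n k q))
    (trans (m/n≡1+[m∸n]/n (m≤m+n q k)) (cong (λ j → suc (j / q)) (m+n∸m≡n q k)))

length-filterᵇ-applyUpTo : ∀ {a} {A : Set a} (p : A → Bool) (h : ℕ → A) n →
                      length (filterᵇ p (applyUpTo h n)) ≡ Σ< n (ind ∘ p ∘ h)
length-filterᵇ-applyUpTo p h zero    = refl
length-filterᵇ-applyUpTo p h (suc n) with p (h 0)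
... | true  = cong suc (length-filterᵇ-applyUpTo p (h ∘ suc) n)
... | false = length-filterᵇ-applyUpTo p (h ∘ suc) n

ℓ₁-Σ< : ∀ g → ℓ₁ g ≡ Σ< (length g) (ind ∘ coeff g)
ℓ₁-Σ< []          = refl
ℓ₁-Σ< (true  ∷ g) = cong suc (ℓ₁-Σ< g)
ℓ₁-Σ< (false ∷ g) = ℓ₁-Σ< g

Σ<-vanish : ∀ m n {f} → (∀ k → f (m + k) ≡ 0) → Σ< (m + n) f ≡ Σ< m f
Σ<-vanish m n {f} v = trans (Σ<-split m n f)
  (trans (cong (Σ< m f +_) (Σ<-zero n (λ {k} _ → v k))) (+-identityʳ _))

-- Either of `length g` and d may be the larger, so both sums are extended to `length g` + d, where
-- they meet.
ℓ₁-bound : ∀ g d → (∀ k → coeff g (d + k) ≡ false) → ℓ₁ g ≡ Σ< d (ind ∘ coeff g)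
ℓ₁-bound g d v = begin
  ℓ₁ g                                ≡⟨ ℓ₁-Σ< g ⟩
  Σ< (length g) (ind ∘ coeff g)       ≡⟨ Σ<-vanish (length g) d (λ k → cong ind (coeff-length g (m≤m+n (length g) k))) ⟨
  Σ< (length g + d) (ind ∘ coeff g)   ≡⟨ cong (λ n → Σ< n (ind ∘ coeff g)) (+-comm (length g) d) ⟩
  Σ< (d + length g) (ind ∘ coeff g)   ≡⟨ Σ<-vanish d (length g) (λ k → cong ind (v k)) ⟩
  Σ< d (ind ∘ coeff g)                ∎
  where open ≡-Reasoning

ind-not : ∀ b → ind b + ind (not b) ≡ 1
ind-not true  = refl
ind-not false = refl

-- The order as least period, and counts over it.

least : ∀ {p} {P : ℕ → Set p} → (∀ d → Dec (P d)) → ∀ n → P n →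
        ∃ λ d → P d × (∀ e → P e → d ≤ e)
least P? zero    pn = 0 , pn , λ _ _ → z≤n
least {P = P} P? (suc n) pn with P? 0
... | yes p0 = 0 , p0 , λ _ _ → z≤n
... | no ¬p0 with least (P? ∘ suc) n pn
...   | d , pd , min = suc d , pd , min′
  where
  min′ : ∀ e → P e → suc d ≤ e
  min′ zero    p0 = contradiction p0 ¬p0
  min′ (suc e) pe = s≤s (min e pe)

module PeriodicReciprocal
  (f : 𝔽₂[x]) (f₀ : coeff f 0 ≡ true) (s : Series) (f⊛s : f ⊛ s ≗ coeff 𝟙)
  (n : ℕ) {{_ : NonZero n}} (per : Period s n) where

  open Reciprocal f f₀ s f⊛s

  period⇒divides : ∀ d → Period s d → f ∣ₚ 𝟙 ⊕ X^ d
  period⇒divides d p = applyUpTo s d , truncation d p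

  order : 1 ≤ degree f → Order f
  -- Zero is trivially a period, so the search runs over `suc d`; the known period n enters it as
  -- `pred n`.
  order 1≤deg with least (λ d → Period? n per (suc d)) (pred n) (subst (Period s) (sym (suc-pred n)) per)
  ... | d , pd , min = record
    { constantTerm = f₀
    ; nonConstant  = 1≤deg
    ; ord          = suc d
    ; dual         = applyUpTo s (suc d)
    ; f⊗dual       = truncation (suc d) pd
    ; minimal      = λ { (suc e) _ f∣ → s≤s (min e (divides⇒period n per f∣)) }
    }

  module _ (o : Order f) where
    open Order o using (ord≢0; f⊗dual; minimal)

    ord-period : Period s (ord o)
    ord-period = divides⇒period n per (dual o , f⊗dual)

    -- The remainder of n modulo the order is again a period, so f divides the corresponding 1 +
    -- x^e. A positive remainder would contradict `minimal`.
    ord∣period : ord o ∣ n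
    ord∣period = m%n≡0⇒n∣m n (ord o) (remainder (n % ord o) refl)
      where
      remainder : ∀ e → n % ord o ≡ e → n % ord o ≡ 0
      remainder zero    eq = eq
      remainder (suc e) eq = contradiction
        (minimal (n % ord o) (subst (1 ≤_) (sym eq) z<s)
          (period⇒divides (n % ord o) (Period-% n per ord-period)))
        (<⇒≱ (m%n<n n (ord o)))

    ℓ₁-dual : ℓ₁ (dual o) ≡ Σ< (ord o) (ind ∘ s)
    ℓ₁-dual = trans (ℓ₁-bound (dual o) (ord o) (dual-vanishes (ord o) (dual o) f⊗dual ord-period))
      (Σ<-cong (ord o) (λ k<d → cong ind (dual-coeff (ord o) (dual o) f⊗dual k<d)))

    ℓ₀-dual : ℓ₀ (ord o ∸ 1) (dual o) ≡ Σ< (ord o) (ind ∘ not ∘ s)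
    ℓ₀-dual = begin
      ℓ₀ (ord o ∸ 1) (dual o)
        ≡⟨ length-filterᵇ-applyUpTo (not ∘ coeff (dual o)) id (suc (ord o ∸ 1)) ⟩
      Σ< (suc (ord o ∸ 1)) (ind ∘ not ∘ coeff (dual o))
        ≡⟨ cong (λ d → Σ< d (ind ∘ not ∘ coeff (dual o))) (suc-pred (ord o)) ⟩
      Σ< (ord o) (ind ∘ not ∘ coeff (dual o))
        ≡⟨ Σ<-cong (ord o) (λ k<d → cong (ind ∘ not) (dual-coeff (ord o) (dual o) f⊗dual k<d)) ⟩
      Σ< (ord o) (ind ∘ not ∘ s) ∎
      where open ≡-Reasoning

    ℓ₁+ℓ₀≡ord : ℓ₁ (dual o) + ℓ₀ (ord o ∸ 1) (dual o) ≡ ord o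
    ℓ₁+ℓ₀≡ord = begin
      ℓ₁ (dual o) + ℓ₀ (ord o ∸ 1) (dual o)                 ≡⟨ cong₂ _+_ ℓ₁-dual ℓ₀-dual ⟩
      Σ< (ord o) (ind ∘ s) + Σ< (ord o) (ind ∘ not ∘ s)     ≡⟨ Σ<-+ (ord o) (ind ∘ s) (ind ∘ not ∘ s) ⟨
      Σ< (ord o) (λ k → ind (s k) + ind (not (s k)))        ≡⟨ Σ<-const (ord o) (λ {k} _ → ind-not (s k)) ⟩
      ord o * 1                                             ≡⟨ *-identityʳ (ord o) ⟩
      ord o                                                 ∎
      where open ≡-Reasoning

    -- The factor m = n / ord is not determined. Zeros and length scale by the same m, so their
    -- ratio can be read off from n.
    zero-count : ∃ λ m → m * ℓ₀ (ord o ∸ 1) (dual o) ≡ Σ< n (ind ∘ not ∘ s) × m * ord o ≡ n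
    zero-count with ord∣period
    ... | divides m n≡ = m , multiple , sym n≡
      where
      open ≡-Reasoning
      multiple : m * ℓ₀ (ord o ∸ 1) (dual o) ≡ Σ< n (ind ∘ not ∘ s)
      multiple = begin
        m * ℓ₀ (ord o ∸ 1) (dual o)
          ≡⟨ cong (m *_) ℓ₀-dual ⟩
        m * Σ< (ord o) (ind ∘ not ∘ s)
          ≡⟨ Σ<-period m (ord o) (ind ∘ not ∘ s) (λ k → cong (ind ∘ not) (ord-period k)) ⟨
        Σ< (m * ord o) (ind ∘ not ∘ s)
          ≡⟨ cong (λ d → Σ< d (ind ∘ not ∘ s)) n≡ ⟨
        Σ< n (ind ∘ not ∘ s) ∎

-- Counting odd binomials and the zeros of u.

odd-binomials : ℕ → ℕ
odd-binomials q = Σ< q (λ b → Σ< q (λ a → ind (row a b)))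

-- Three of the four quadrants are copies of the smaller triangle, the fourth is empty.
odd-binomials-double : ∀ {q} → Frobenius q → odd-binomials (q + q) ≡ 3 * odd-binomials q
odd-binomials-double {q} frob = begin
  Σ< (q + q) (λ b → Σ< (q + q) (λ a → ind (row a b)))
    ≡⟨ Σ<-split q q _ ⟩
  Σ< q (λ b → Σ< (q + q) (λ a → ind (row a b))) + Σ< q (λ b → Σ< (q + q) (λ a → ind (row a (q + b))))
    ≡⟨ cong₂ _+_ left right ⟩
  (odd-binomials q + odd-binomials q) + odd-binomials q
    ≡⟨ triple (odd-binomials q) ⟩
  3 * odd-binomials q ∎
  where
  open ≡-Reasoning
  triple : ∀ x → x + x + x ≡ 3 * x
  triple = solve-∀

  near : ∀ {a b} → b < q → row (q + a) b ≡ row a b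
  near {a} {b} b<q = trans (cong (λ m → row m b) (+-comm q a))
    (trans (row-+ frob a b) (⊞-shift-< (row a) b<q))

  far : ∀ {a} b → a < q → row (q + a) (q + b) ≡ row a b
  far {a} b a<q = trans (cong (λ m → row m (q + b)) (+-comm q a))
    (trans (row-+ frob a (q + b)) (cong₂ _xor_ (row-> (<-≤-trans a<q (m≤m+n q b))) (shift-+ q (row a) b)))

  left : Σ< q (λ b → Σ< (q + q) (λ a → ind (row a b))) ≡ odd-binomials q + odd-binomials q
  left = trans
    (Σ<-cong q (λ {b} b<q → trans (Σ<-split q q (λ a → ind (row a b)))
      (cong (Σ< q (λ a → ind (row a b)) +_) (Σ<-cong q (λ {a} _ → cong ind (near {a} b<q))))))
    (Σ<-+ q (λ b → Σ< q (λ a → ind (row a b))) (λ b → Σ< q (λ a → ind (row a b))))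

  right : Σ< q (λ b → Σ< (q + q) (λ a → ind (row a (q + b)))) ≡ odd-binomials q
  right = Σ<-cong q (λ {b} _ → trans (Σ<-split q q (λ a → ind (row a (q + b))))
    (cong₂ _+_ (Σ<-zero q (λ a<q → cong ind (row-> (<-≤-trans a<q (m≤m+n q b)))))
               (Σ<-cong q (λ a<q → cong ind (far b a<q)))))

odd-binomials-2^ : ∀ r → odd-binomials (2 ^ r) ≡ 3 ^ r
odd-binomials-2^ zero    = refl
odd-binomials-2^ (suc r) = begin
  odd-binomials (2 ^ r + (2 ^ r + 0))   ≡⟨ cong (λ m → odd-binomials (2 ^ r + m)) (+-identityʳ (2 ^ r)) ⟩
  odd-binomials (2 ^ r + 2 ^ r)         ≡⟨ odd-binomials-double {2 ^ r} (frobenius-2^ r) ⟩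
  3 * odd-binomials (2 ^ r)             ≡⟨ cong (3 *_) (odd-binomials-2^ r) ⟩
  3 ^ suc r                             ∎
  where open ≡-Reasoning

module _ (q : ℕ) {{_ : NonZero q}} (frob : Frobenius q) where
  open PartialInverse q frob

  -- The zeros below q² mark the odd C(a,b+1), that is, the columns 1 to q of the triangle. Column q
  -- is empty, while column 0 is missing and holds q ones. The q + 1 zeros from q² onwards replace
  -- column 0 and leave one over: the origin of the 1 in 3^r + 1.
  zeros-of-u : Σ< (q * q + suc q) (ind ∘ not ∘ u) ≡ suc (odd-binomials q)
  zeros-of-u = begin
    Σ< (q * q + suc q) (ind ∘ not ∘ u)
      ≡⟨ Σ<-split (q * q) (suc q) (ind ∘ not ∘ u) ⟩
    Σ< (q * q) (ind ∘ not ∘ u) + Σ< (suc q) (λ k → ind (not (u (q * q + k))))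
      ≡⟨ cong₂ _+_ (Σ<-grid q (ind ∘ not) q u-entry) (Σ<-const (suc q) (λ {k} _ → cong (ind ∘ not) (u-vanishes k))) ⟩
    Σ< q (λ b → Σ< q (λ a → ind (not (u-entry a b)))) + suc q * 1
      ≡⟨ cong₂ _+_ (Σ<-cong q (λ {b} b<q → Σ<-cong q (λ {a} _ → cong ind (not-entry a b<q)))) (*-identityʳ (suc q)) ⟩
    Σ< q (column ∘ suc) + suc q
      ≡⟨ trans (+-suc _ q) (cong suc (+-comm _ q)) ⟩
    suc (q + Σ< q (column ∘ suc))
      ≡⟨ cong (λ m → suc (m + Σ< q (column ∘ suc))) column-0 ⟨
    suc (Σ< (suc q) column)
      ≡⟨ cong suc (Σ<-suc-last q column) ⟩
    suc (odd-binomials q + column q)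
      ≡⟨ cong (λ m → suc (odd-binomials q + m)) (Σ<-zero q (λ a<q → cong ind (row-> a<q))) ⟩
    suc (odd-binomials q + 0)
      ≡⟨ cong suc (+-identityʳ (odd-binomials q)) ⟩
    suc (odd-binomials q) ∎
    where
    open ≡-Reasoning
    column : ℕ → ℕ
    column b = Σ< q (λ a → ind (row a b))

    column-0 : column 0 ≡ q
    column-0 = trans (Σ<-const q (λ {a} _ → cong ind (row-0 a))) (*-identityʳ q)

    not-entry : ∀ a {b} → b < q → not (u-entry a b) ≡ row a (suc b)
    not-entry a {b} b<q rewrite <⇒<ᵇ≡true b<q = not-involutive (row a (suc b))

-- Reciprocal and degree of the concrete polynomials.

replicate-∷ʳ : ∀ {a} {A : Set a} n (x : A) ys → replicate n x ++ x ∷ ys ≡ x ∷ replicate n x ++ ys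
replicate-∷ʳ zero    x ys = refl
replicate-∷ʳ (suc n) x ys = cong (x ∷_) (replicate-∷ʳ n x ys)

reverse-replicate : ∀ {a} {A : Set a} n (x : A) → reverse (replicate n x) ≡ replicate n x
reverse-replicate zero    x = refl
reverse-replicate (suc n) x = begin
  reverse (x ∷ replicate n x)         ≡⟨ unfold-reverse x (replicate n x) ⟩
  reverse (replicate n x) ++ [ x ]    ≡⟨ cong (_++ [ x ]) (reverse-replicate n x) ⟩
  replicate n x ++ [ x ]              ≡⟨ replicate-∷ʳ n x [] ⟩
  x ∷ replicate n x ++ []             ≡⟨ cong (x ∷_) (List.++-identityʳ (replicate n x)) ⟩
  x ∷ replicate n x                   ∎
  where open ≡-Reasoning

reverse-replicate-++ : ∀ n (b c d : Bool) ys →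
  reverse (b ∷ c ∷ replicate n false ++ ys) ≡ reverse ys ++ replicate n false ++ c ∷ b ∷ []
reverse-replicate-++ n b c d ys = begin
  reverse ((b ∷ c ∷ replicate n false) ++ ys)
    ≡⟨ reverse-++ (b ∷ c ∷ replicate n false) ys ⟩
  reverse ys ++ reverse ((b ∷ c ∷ []) ++ replicate n false)
    ≡⟨ cong (reverse ys ++_) (reverse-++ (b ∷ c ∷ []) (replicate n false)) ⟩
  reverse ys ++ reverse (replicate n false) ++ c ∷ b ∷ []
    ≡⟨ cong (λ zs → reverse ys ++ zs ++ c ∷ b ∷ []) (reverse-replicate n false) ⟩
  reverse ys ++ replicate n false ++ c ∷ b ∷ [] ∎
  where open ≡-Reasoning

X^-⊕-X^+1 : ∀ n → X^ n ⊕ X^ (n + 1) ≡ replicate n false ++ true ∷ true ∷ []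
X^-⊕-X^+1 zero    = refl
X^-⊕-X^+1 (suc n) = cong (false ∷_) (X^-⊕-X^+1 n)

X^-⊕-X^+2 : ∀ n → X^ n ⊕ X^ (n + 2) ≡ replicate n false ++ true ∷ false ∷ true ∷ []
X^-⊕-X^+2 zero    = refl
X^-⊕-X^+2 (suc n) = cong (false ∷_) (X^-⊕-X^+2 n)

fR : ℕ → 𝔽₂[x]
fR q = 𝟙 ⊕ X^ 2 ⊕ X^ (q + 1) ⊕ X^ (q + 2)

-- Writing q as 2 + n keeps the exponents 0, 2, q + 1, q + 2 distinct. For q = 1 the two terms x²
-- would cancel.
fR-list : ∀ n → fR (2 + n) ≡ true ∷ false ∷ true ∷ replicate n false ++ true ∷ true ∷ []
fR-list n rewrite +-comm n 2 | +-comm n 1 =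
  cong (λ g → true ∷ false ∷ true ∷ g) (trans (cong (λ m → X^ n ⊕ X^ m) (+-comm 1 n)) (X^-⊕-X^+1 n))

-- The list of the right-hand polynomial ends in `true`, so `dropWhileᵇ` removes nothing and
-- `reciprocal` is plain reversal.
fR-reciprocal : ∀ n → fR (2 + n) ≡ reciprocal (𝟙 ⊕ X^ 1 ⊕ X^ (2 + n) ⊕ X^ (2 + n + 2))
fR-reciprocal n = begin
  fR (2 + n)
    ≡⟨ fR-list n ⟩
  true ∷ false ∷ true ∷ replicate n false ++ true ∷ true ∷ []
    ≡⟨ cong (dropWhileᵇ not) (reverse-replicate-++ n true true true (true ∷ false ∷ true ∷ [])) ⟨
  reciprocal (true ∷ true ∷ replicate n false ++ true ∷ false ∷ true ∷ [])
    ≡⟨ cong (λ g → reciprocal (true ∷ true ∷ g)) (X^-⊕-X^+2 n) ⟨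
  reciprocal (true ∷ true ∷ (X^ n ⊕ X^ (n + 2))) ∎
  where open ≡-Reasoning

fR-degree : ∀ n → 1 ≤ degree (fR (2 + n))
fR-degree n = subst (λ g → 1 ≤ degree g) (sym (fR-list n))
  (subst (λ l → 1 ≤ length (dropWhileᵇ not l) ∸ 1)
    (sym (reverse-++ (true ∷ false ∷ true ∷ replicate n false) (true ∷ true ∷ []))) z<s)

-- Comparing powers of 3 and 4.

-- Bernoulli's inequality for (4/3)ʳ, multiplied by 3ʳ⁺¹.
bernoulli : ∀ r → (3 + r) * 3 ^ r ≤ 3 * 4 ^ r
bernoulli zero    = ≤-refl
bernoulli (suc r) = begin
  (4 + r) * (3 * 3 ^ r)                     ≤⟨ m≤m+n _ (r * 3 ^ r) ⟩
  (4 + r) * (3 * 3 ^ r) + r * 3 ^ r         ≡⟨ regroup r (3 ^ r) ⟩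
  4 * ((3 + r) * 3 ^ r)                     ≤⟨ *-monoʳ-≤ 4 (bernoulli r) ⟩
  4 * (3 * 4 ^ r)                           ≡⟨ swap (4 ^ r) ⟩
  3 * (4 * 4 ^ r)                           ∎
  where
  open ≤-Reasoning
  regroup : ∀ r x → (4 + r) * (3 * x) + r * x ≡ 4 * ((3 + r) * x)
  regroup = solve-∀
  swap : ∀ x → 4 * (3 * x) ≡ 3 * (4 * x)
  swap = solve-∀

n≤3^n : ∀ n → n ≤ 3 ^ n
n≤3^n zero    = z≤n
n≤3^n (suc n) = begin
  1 + n                   ≤⟨ +-mono-≤ (m^n>0 3 n) (n≤3^n n) ⟩
  3 ^ n + 3 ^ n           ≤⟨ +-monoʳ-≤ (3 ^ n) (m≤m+n (3 ^ n) _) ⟩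
  3 ^ suc n               ∎
  where open ≤-Reasoning

-- Bernoulli gives (4/3)^r at least 1 + r/3, so r ≥ 3d makes room for d + 1 copies of 3^r. The extra
-- copy absorbs the stray d, since d ≤ r ≤ 3^r.
3^r-small : ∀ r d → 3 * d ≤ r → suc (3 ^ r) * d ≤ 4 ^ r
3^r-small r d 3d≤r = begin
  d + 3 ^ r * d           ≤⟨ +-monoˡ-≤ _ (≤-trans (m≤n*m d 3) (≤-trans 3d≤r (n≤3^n r))) ⟩
  3 ^ r + 3 ^ r * d       ≡⟨ cong (3 ^ r +_) (*-comm (3 ^ r) d) ⟩
  suc d * 3 ^ r           ≤⟨ *-cancelˡ-≤ 3 (begin
    3 * (suc d * 3 ^ r)     ≡⟨ *-assoc 3 (suc d) (3 ^ r) ⟨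
    3 * suc d * 3 ^ r       ≡⟨ cong (_* 3 ^ r) (*-suc 3 d) ⟩
    (3 + 3 * d) * 3 ^ r     ≤⟨ *-monoˡ-≤ (3 ^ r) (+-monoʳ-≤ 3 3d≤r) ⟩
    (3 + r) * 3 ^ r         ≤⟨ bernoulli r ⟩
    3 * 4 ^ r               ∎) ⟩
  4 ^ r                   ∎
  where open ≤-Reasoning

-- The induction starts at r = 4 with 246 ≤ 256. At r = 3 the inequality fails, 84 against 64, which
-- is why `robust-count` treats that case apart.
4^r-large : ∀ i → 3 * suc (3 ^ (4 + i)) ≤ 4 ^ (4 + i)
4^r-large zero    = ≤ᵇ⇒≤ _ _ _
4^r-large (suc i) = begin
  3 * suc (3 * x)           ≤⟨ m≤m+n _ (3 * x + 9) ⟩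
  3 * suc (3 * x) + (3 * x + 9)     ≡⟨ regroup x ⟩
  4 * (3 * suc x)           ≤⟨ *-monoʳ-≤ 4 (4^r-large i) ⟩
  4 ^ suc (4 + i)           ∎
  where
  open ≤-Reasoning
  x = 3 ^ (4 + i)
  regroup : ∀ x → 3 * suc (3 * x) + (3 * x + 9) ≡ 4 * (3 * suc x)
  regroup = solve-∀

4^≡2^*2^ : ∀ r → 4 ^ r ≡ 2 ^ r * 2 ^ r
4^≡2^*2^ zero    = refl
4^≡2^*2^ (suc r) = trans (cong (4 *_) (4^≡2^*2^ r)) (regroup (2 ^ r))
  where
  regroup : ∀ x → 4 * (x * x) ≡ 2 * x * (2 * x)
  regroup = solve-∀

-- If the ones did not exceed the zeros by two, there would be at most three
-- times as many coefficients as zeros, which is false for r ≥ 4.  For r = 3 the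
-- counts 28 and 73 over the full period are coprime, so m = 1.
robust-count : ∀ r → 3 ≤ r → ∀ m ones zeros → m * zeros ≡ suc (3 ^ r) →
               m * (ones + zeros) ≡ 4 ^ r + 2 ^ r + 1 → ones > zeros + 1
robust-count 0 () _ _ _ _ _
robust-count 1 (s≤s ()) _ _ _ _ _
robust-count 2 (s≤s (s≤s ())) _ _ _ _ _
robust-count 3 _ m ones zeros eq₀ eq
  with ∣1⇒≡1 {m} (gcd-greatest {28} {73}
    (divides zeros (trans (sym eq₀) (*-comm m zeros)))
    (divides (ones + zeros) (trans (sym eq) (*-comm m (ones + zeros)))))
... | refl with trans (sym (+-identityʳ zeros)) eq₀
...   | refl = subst (_> 29)
  (sym (+-cancelʳ-≡ 28 ones 45 (trans (sym (+-identityʳ (ones + 28))) eq))) (<ᵇ⇒< _ _ _)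
robust-count r@(suc (suc (suc (suc i)))) _ m ones zeros eq₀ eq with <-≤-connex (zeros + 1) ones
... | inj₁ ones> = ones>
... | inj₂ ones≤ = contradiction (begin
  4 ^ r + 2 ^ r + 1            ≡⟨ eq ⟨
  m * (ones + zeros)           ≤⟨ *-monoʳ-≤ m (+-monoˡ-≤ zeros (≤-trans ones≤ (+-monoʳ-≤ zeros 0<zeros))) ⟩
  m * (zeros + zeros + zeros)  ≡⟨ triple m zeros ⟩
  3 * (m * zeros)              ≡⟨ cong (3 *_) eq₀ ⟩
  3 * suc (3 ^ r)              ≤⟨ 4^r-large i ⟩
  4 ^ r                        ∎)
  (<⇒≱ (≤-<-trans (m≤m+n (4 ^ r) (2 ^ r)) (m<m+n _ z<s)))
  where
  open ≤-Reasoning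
  triple : ∀ m z → m * (z + z + z) ≡ 3 * (m * z)
  triple = solve-∀
  0<zeros : 0 < zeros
  0<zeros = n≢0⇒n>0 λ { refl → contradiction (trans (sym eq₀) (*-zeroʳ m)) λ () }

-- From counts to distances in the rationals.

-- The distance is zeros/d, and a positive ε is at least 1 over its denominator. The computation
-- runs in unnormalised fractions, where no common factors are cancelled.
∣ratio-1∣<ε : ∀ ones zeros d .{{_ : NonZero d}} (ε : ℚ) → 0ℚ ℚ.< ε → ones + zeros ≡ d →
              zeros * ℚ.denominatorℕ ε < d → ℚ.∣ (ℤ.+ ones) ℚ./ d ℚ.- 1ℚ ∣ ℚ.< ε
∣ratio-1∣<ε ones zeros (suc d-1) (mkℚ (ℤ.+ zero) e-1 _) (ℚ.*<* (+<+ ())) _ _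
∣ratio-1∣<ε ones zeros d@(suc d-1) ε@(mkℚ ℤ.+[1+ p ] e-1 _) _ sum small =
  ℚ.toℚᵘ-cancel-< (ℚᵘ.<-respˡ-≃ (ℚᵘ.≃-sym value) (*<*
    (subst₂ ℤ._<_ (ℤ.pos-* zeros (suc e-1)) (ℤ.pos-* (suc p) d)
      (+<+ (<-≤-trans small (m≤n*m d (suc p)))))))
  where
  open ℚᵘ.≃-Reasoning
  difference : mkℚᵘ (ℤ.+ ones) d-1 ℚᵘ.+ ℚᵘ.- ℚᵘ.1ℚᵘ ℚᵘ.≃ ℚᵘ.- mkℚᵘ (ℤ.+ zeros) d-1
  difference = *≡* (cong₂ ℤ._*_ numerators (cong ℤ.+_ (sym (*-identityʳ d))))
    where
    cancel : ∀ a b → a ℤ.* ℤ.1ℤ ℤ.+ ℤ.- ℤ.1ℤ ℤ.* (a ℤ.+ b) ≡ ℤ.- b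
    cancel = ℤ-solve-∀
    numerators : ℤ.+ ones ℤ.* ℤ.1ℤ ℤ.+ ℤ.- ℤ.1ℤ ℤ.* ℤ.+ d ≡ ℤ.- ℤ.+ zeros
    numerators = trans
      (cong (λ x → ℤ.+ ones ℤ.* ℤ.1ℤ ℤ.+ ℤ.- ℤ.1ℤ ℤ.* x) (trans (cong ℤ.+_ (sym sum)) (ℤ.pos-+ ones zeros)))
      (cancel (ℤ.+ ones) (ℤ.+ zeros))

  value : ℚ.toℚᵘ ℚ.∣ (ℤ.+ ones) ℚ./ d ℚ.- 1ℚ ∣ ℚᵘ.≃ mkℚᵘ (ℤ.+ zeros) d-1
  value = begin
    ℚ.toℚᵘ ℚ.∣ (ℤ.+ ones) ℚ./ d ℚ.- 1ℚ ∣
      ≈⟨ ℚ.toℚᵘ-homo-∣-∣ ((ℤ.+ ones) ℚ./ d ℚ.- 1ℚ) ⟩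
    ℚᵘ.∣ ℚ.toℚᵘ ((ℤ.+ ones) ℚ./ d ℚ.- 1ℚ) ∣
      ≈⟨ ℚᵘ.∣-∣-cong (ℚ.toℚᵘ-homo-+ ((ℤ.+ ones) ℚ./ d) (ℚ.- 1ℚ)) ⟩
    ℚᵘ.∣ ℚ.toℚᵘ ((ℤ.+ ones) ℚ./ d) ℚᵘ.- ℚᵘ.1ℚᵘ ∣
      ≈⟨ ℚᵘ.∣-∣-cong (ℚᵘ.+-congˡ (ℚᵘ.- ℚᵘ.1ℚᵘ) (ℚ.toℚᵘ-fromℚᵘ (mkℚᵘ (ℤ.+ ones) d-1))) ⟩
    ℚᵘ.∣ mkℚᵘ (ℤ.+ ones) d-1 ℚᵘ.- ℚᵘ.1ℚᵘ ∣
      ≈⟨ ℚᵘ.∣-∣-cong difference ⟩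
    ℚᵘ.∣ ℚᵘ.- mkℚᵘ (ℤ.+ zeros) d-1 ∣
      ≈⟨ ℚᵘ.∣-p∣≃∣p∣ (mkℚᵘ (ℤ.+ zeros) d-1) ⟩
    mkℚᵘ (ℤ.+ zeros) d-1 ∎

-- The case q = 2^r.

module PowerOfTwo (r : ℕ) (3≤r : 3 ≤ r) where

  private
    q : ℕ
    q = 2 ^ r

    instance
      q≢0 : NonZero q
      q≢0 = m^n≢0 2 r

    q-2 : ℕ
    q-2 = q ∸ 2

    2+[q-2]≡q : 2 + q-2 ≡ q
    2+[q-2]≡q = m+[n∸m]≡n (^-monoʳ-≤ 2 {1} {r} (≤-trans (s≤s z≤n) 3≤r))

  open PartialInverse q (frobenius-2^ r)

  fR-constant : coeff (fR q) 0 ≡ true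
  fR-constant = subst (λ m → coeff (fR m) 0 ≡ true) 2+[q-2]≡q (cong (λ g → coeff g 0) (fR-list q-2))

  fR-nonconstant : 1 ≤ degree (fR q)
  fR-nonconstant = subst (λ m → 1 ≤ degree (fR m)) 2+[q-2]≡q (fR-degree q-2)

  fR₂-reciprocal : fR₂ r ≡ reciprocal (f₂ r)
  fR₂-reciprocal =
    subst (λ m → fR m ≡ reciprocal (𝟙 ⊕ X^ 1 ⊕ X^ m ⊕ X^ (m + 2))) 2+[q-2]≡q (fR-reciprocal q-2)

  period≡q*q+suc-q : period ≡ q * q + suc q
  period≡q*q+suc-q = trans (cong suc (+-comm q (q * q))) (sym (+-suc (q * q) q))

  period≡4^r+2^r+1 : period ≡ 4 ^ r + 2 ^ r + 1
  period≡4^r+2^r+1 = begin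
    suc (q + q * q)       ≡⟨ cong suc (+-comm q (q * q)) ⟩
    suc (q * q + q)       ≡⟨ +-comm 1 (q * q + q) ⟩
    q * q + q + 1         ≡⟨ cong (λ m → m + q + 1) (4^≡2^*2^ r) ⟨
    4 ^ r + 2 ^ r + 1     ∎
    where open ≡-Reasoning

  u-vanishes-beyond-period : ∀ k → u (period + k) ≡ false
  u-vanishes-beyond-period k =
    trans (cong u (trans (cong (_+ k) period≡q*q+suc-q) (+-assoc (q * q) (suc q) k)))
          (u-vanishes (suc q + k))

  open PeriodicReciprocal (fR q) fR-constant (periodise period u)
    (⊛-periodise (fR q) period u-vanishes-beyond-period ⊛-u)
    period (periodise-period period u) public

  zeros-in-period : Σ< period (ind ∘ not ∘ periodise period u) ≡ suc (3 ^ r)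
  zeros-in-period = begin
    Σ< period (ind ∘ not ∘ periodise period u)
      ≡⟨ Σ<-cong period (λ k<n → cong (ind ∘ not ∘ u) (m<n⇒m%n≡m k<n)) ⟩
    Σ< period (ind ∘ not ∘ u)
      ≡⟨ cong (λ n → Σ< n (ind ∘ not ∘ u)) period≡q*q+suc-q ⟩
    Σ< (q * q + suc q) (ind ∘ not ∘ u)
      ≡⟨ zeros-of-u q (frobenius-2^ r) ⟩
    suc (odd-binomials q)
      ≡⟨ cong suc (odd-binomials-2^ r) ⟩
    suc (3 ^ r) ∎
    where open ≡-Reasoning

  fR₂-order : Order (fR₂ r)
  fR₂-order = order fR-nonconstant

  module _ (o : Order (fR₂ r)) where

    ord∣4^r+2^r+1 : ord o ∣ 4 ^ r + 2 ^ r + 1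
    ord∣4^r+2^r+1 = subst (ord o ∣_) period≡4^r+2^r+1 (ord∣period o)

    private
      ones  = ℓ₁ (dual o)
      zeros = ℓ₀ (ord o ∸ 1) (dual o)

    robust : Robust o
    robust = let m , m*zeros , m*ord = zero-count o in
      robust-count r 3≤r m ones zeros (trans m*zeros zeros-in-period)
        (trans (cong (m *_) (ℓ₁+ℓ₀≡ord o)) (trans m*ord period≡4^r+2^r+1))

    -- Multiplying by m trades the unknown order for 4^r + 2^r + 1 and the unknown number of zeros
    -- for 3^r + 1. Afterwards m is cancelled.
    few-zeros : ∀ d → 3 * d ≤ r → zeros * d < ord o
    few-zeros d 3d≤r = let m , m*zeros , m*ord = zero-count o in
      *-cancelˡ-< m (zeros * d) (ord o) (begin-strict
      m * (zeros * d)           ≡⟨ *-assoc m zeros d ⟨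
      m * zeros * d             ≡⟨ cong (_* d) (trans m*zeros zeros-in-period) ⟩
      suc (3 ^ r) * d           ≤⟨ 3^r-small r d 3d≤r ⟩
      4 ^ r                     ≤⟨ m≤m+n (4 ^ r) (2 ^ r) ⟩
      4 ^ r + 2 ^ r             <⟨ m<m+n (4 ^ r + 2 ^ r) z<s ⟩
      4 ^ r + 2 ^ r + 1         ≡⟨ trans m*ord period≡4^r+2^r+1 ⟨
      m * ord o                 ∎)
      where open ≤-Reasoning

    ∣γ-1∣<ε : ∀ ε → 0ℚ ℚ.< ε → 3 * ℚ.denominatorℕ ε ≤ r → ℚ.∣ γ o ℚ.- 1ℚ ∣ ℚ.< ε
    ∣γ-1∣<ε ε 0<ε 3d≤r =
      ∣ratio-1∣<ε ones zeros (ord o) {{Order.ord≢0 o}} ε 0<ε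
        (ℓ₁+ℓ₀≡ord o) (few-zeros (ℚ.denominatorℕ ε) 3d≤r)

mainTheorem4 : (∀ r → 3 ≤ r →
    fR₂ r ≈ reciprocal (f₂ r)
    × Order (fR₂ r)
    × (∀ (o : Order (fR₂ r)) → Robust o × ord o ∣ 4 ^ r + 2 ^ r + 1))
    × (∀ (ε : ℚ) → 0ℚ ℚ.< ε →
    ∃ λ R → ∀ r → 3 ≤ r → R ≤ r → ∀ (o : Order (fR₂ r)) → ℚ.∣ γ o ℚ.- 1ℚ ∣ ℚ.< ε)
mainTheorem4 =
  (λ r 3≤r → let open PowerOfTwo r 3≤r in
    (λ k → cong (λ f → coeff f k) fR₂-reciprocal) , fR₂-order , λ o → robust o , ord∣4^r+2^r+1 o) ,
  -- The threshold is the one required by `3^r-small`, with d the denominator of ε.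
  λ ε 0<ε → 3 * ℚ.denominatorℕ ε , λ r 3≤r R≤r o → PowerOfTwo.∣γ-1∣<ε r 3≤r o ε 0<ε R≤r
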